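{- Let $\kappa$ be a regular cardinal and $M=\langle W,S\rangle$ a $\kappa$-downward directed multi-relational Kripke frame. Then $\theta_M:W\to\mathrm{At}(G(M))$, $\theta_M(w)=\{w\}$, is an isomorphism of multi-relational Kripke frames from $M$ to $F(G(M))$.
   Context: A multi-relational Kripke frame is a pair $\langle W,S\rangle$ with $W$ non-empty and $S$ a non-empty set of binary relations on $W$; it is $\kappa$-downward directed if for every $S'\subseteq S$ with $|S'|<\kappa$ there is $R\in S$ with $R\subseteq\bigcap S'$ (with $\bigcap\emptyset=W\times W$). A homomorphism $g:\langle W_1,S_1\rangle\to\langle W_2,S_2\rangle$ is a map $g:W_1\to W_2$ such that: (i) for every $x\in W_1$ and $R_2\in S_2$ there is $R_1\in S_1$ such that for all $y\in W_1$, $xR_1y$ implies $g(x)R_2g(y)$; (ii) for every $x\in W_1$ and $R_1\in S_1$ there is $R_2\in S_2$ such that for all $u\in W_2$, if $g(x)R_2u$ then there exists $y\in W_1$ with $xR_1y$ and $g(y)=u$. An isomorphism is a bijective homomorphism. $G(M)$ is the powerset Boolean algebra $\mathcal P(W)$ with $\Diamond_MX=\{w\mid\forall R\in S\ \exists x\in X\ (wRx)\}$; its atoms are the singletons. For a complete atomic modal algebra $A$, $F(A)=\langle\mathrm{At}(A),\{R(X)\mid X\subseteq A,|X|<\kappa\}\rangle$ with $a\,R(X)\,c\iff a\leq\bigwedge\{\Diamond x\mid x\in X,\ c\leq x\}$ (empty meet $=1$). -}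

module Defs where

open import Algebra.Lattice.Bundles using (BooleanAlgebra)
import Algebra.Lattice.Properties.Lattice as LatticeProperties
open import Axiom.ExcludedMiddle using (ExcludedMiddle)
open import Data.Bool.Base using (Bool; true; false; T; not) renaming (_∨_ to _or_; _∧_ to _and_)
open import Data.Bool.Properties
  using ( T-∨; T-∧; ∨-comm; ∨-assoc; ∧-comm; ∧-assoc; ∨-abs-∧; ∧-abs-∨
        ; ∨-distrib-∧; ∧-distrib-∨; ∨-inverse; ∧-inverse )
open import Data.Empty using (⊥-elim) renaming (⊥ to Empty)
open import Data.Nat.Base using (ℕ)
open import Data.Product.Base using (Σ; ∃; _×_; _,_; proj₁; proj₂)
open import Data.Product.Relation.Binary.Pointwise.NonDependent using (_×ₛ_)
open import Data.Sum.Base using (_⊎_; inj₁; inj₂)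
open import Function.Base using (_∘_)
open import Function.Bundles using (Func; Injection; _⟨$⟩_; Equivalence)
open import Function.Definitions using (Bijective)
open import Function.Relation.Binary.Setoid.Equality using (_⇨_)
open import Induction.WellFounded using (WellFounded)
open import Level using (suc; Lift; lift; lower)
open import Relation.Binary.Bundles using (Setoid; Poset)
open import Relation.Binary.Construct.On as On using ()
open import Relation.Binary.Core using (Rel)
open import Relation.Binary.Definitions using (tri<; tri≈; tri>)
open import Relation.Binary.PropositionalEquality using (_≡_; refl; sym; cong; cong₂; subst) renaming (setoid to ≡-setoid)
open import Relation.Binary.Structures using (IsStrictTotalOrder)
open import Relation.Nullary using (¬_; yes; no; isYes; toWitness; fromWitness; decidable-stable)

-- The mathematics takes place in classical set theory.  A "set" is a setoid,
-- and a subset is a Bool-valued characteristic function respecting equality.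
-- Bool-valued (rather than Set-valued) subsets keep iterated powersets in a
-- single universe; the constructions below that need comprehension take
-- excluded middle as an argument.  Since ExcludedMiddle decides every type, it
-- also yields type-theoretic choice, so no further axiom is used.

𝒫 : ∀ {ℓ} → Setoid ℓ ℓ → Setoid ℓ ℓ
𝒫 A = A ⇨ ≡-setoid Bool

Subset : ∀ {ℓ} → Setoid ℓ ℓ → Set ℓ
Subset A = Setoid.Carrier (𝒫 A)

module _ {ℓ} {A : Setoid ℓ ℓ} where

  open Setoid A using (_≈_) renaming (Carrier to ∣A∣)

  infix 4 _∈_ _⊆_

  _∈_ : ∣A∣ → Subset A → Set
  a ∈ X = T (X ⟨$⟩ a)

  _⊆_ : Subset A → Subset A → Set ℓ
  X ⊆ Y = ∀ a → a ∈ X → a ∈ Y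

  ∈-resp : (X : Subset A) → ∀ {a b} → a ≈ b → a ∈ X → b ∈ X
  ∈-resp X a≈b = subst T (Func.cong X a≈b)

  ⟪_⟫ : Subset A → Setoid ℓ ℓ
  ⟪ X ⟫ = On.setoid {B = Σ ∣A∣ (_∈ X)} A proj₁

Relation : ∀ {ℓ} → Setoid ℓ ℓ → Setoid ℓ ℓ
Relation W = 𝒫 (W ×ₛ W)

-- Regular cardinals, as initial ordinals: an infinite well-ordered set which
-- does not inject into a proper initial segment and into which no proper
-- initial segment maps cofinally.

record RegularCardinal ℓ : Set (suc ℓ) where
  infix 4 _<_
  field
    Carrier            : Set ℓ
    _<_                : Rel Carrier ℓ
    isStrictTotalOrder : IsStrictTotalOrder _≡_ _<_
    wellFounded        : WellFounded _<_

  segment : Carrier → Setoid ℓ ℓ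
  segment k = On.setoid {B = ∃ λ j → j < k} (≡-setoid Carrier) proj₁

  field
    initial  : ∀ k → ¬ Injection (≡-setoid Carrier) (segment k)
    infinite : Injection (≡-setoid ℕ) (≡-setoid Carrier)
    regular  : ∀ k (f : Func (segment k) (≡-setoid Carrier)) →
               ∃ λ b → ∀ i → (f ⟨$⟩ i) < b

-- |A| < κ: the cardinals below κ are the cardinalities of its elements k, each
-- k being identified with the set of its predecessors.

infix 4 _≺_

_≺_ : ∀ {ℓ} → Setoid ℓ ℓ → RegularCardinal ℓ → Set ℓ
A ≺ κ = ∃ λ k → Injection A (RegularCardinal.segment κ k)

record Frame ℓ : Set (suc ℓ) where
  field
    W     : Setoid ℓ ℓ
    S     : Subset (Relation W)
    world : Setoid.Carrier W
    rel   : ∃ λ R → R ∈ S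

  World : Set ℓ
  World = Setoid.Carrier W

DownwardDirected : ∀ {ℓ} → RegularCardinal ℓ → Frame ℓ → Set ℓ
DownwardDirected κ M =
  (S′ : Subset (Relation W)) → S′ ⊆ S → ⟪ S′ ⟫ ≺ κ →
  ∃ λ R → R ∈ S × (∀ x y → (x , y) ∈ R → ∀ R′ → R′ ∈ S′ → (x , y) ∈ R′)
  where open Frame M

module _ {ℓ} (M₁ M₂ : Frame ℓ) where

  private
    module M₁ = Frame M₁
    module M₂ = Frame M₂

  record IsHomomorphism (g : Func M₁.W M₂.W) : Set ℓ where
    field
      forth : ∀ x R₂ → R₂ ∈ M₂.S →
              ∃ λ R₁ → R₁ ∈ M₁.S ×
                (∀ y → (x , y) ∈ R₁ → (g ⟨$⟩ x , g ⟨$⟩ y) ∈ R₂)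
      back  : ∀ x R₁ → R₁ ∈ M₁.S →
              ∃ λ R₂ → R₂ ∈ M₂.S ×
                (∀ u → (g ⟨$⟩ x , u) ∈ R₂ →
                  ∃ λ y → (x , y) ∈ R₁ × Setoid._≈_ M₂.W (g ⟨$⟩ y) u)

  record IsIsomorphism (g : Func M₁.W M₂.W) : Set ℓ where
    field
      isHomomorphism : IsHomomorphism g
      bijective      : Bijective (Setoid._≈_ M₁.W) (Setoid._≈_ M₂.W) (g ⟨$⟩_)

record CompleteAtomicModalAlgebra ℓ : Set (suc ℓ) where
  field
    booleanAlgebra : BooleanAlgebra ℓ ℓ

  open BooleanAlgebra booleanAlgebra public renaming (¬_ to ∁_) hiding (sym; trans; refl)
  open Poset (LatticeProperties.poset lattice) public using (_≤_)

  IsAtom : Carrier → Set ℓ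
  IsAtom a = ¬ (a ≈ ⊥) × (∀ x → x ≤ a → x ≈ ⊥ ⊎ x ≈ a)

  field
    ⋁ ⋀        : Subset setoid → Carrier
    ⋁-upper    : ∀ X x → x ∈ X → x ≤ ⋁ X
    ⋁-least    : ∀ X u → (∀ x → x ∈ X → x ≤ u) → ⋁ X ≤ u
    ⋀-lower    : ∀ X x → x ∈ X → ⋀ X ≤ x
    ⋀-greatest : ∀ X l → (∀ x → x ∈ X → l ≤ x) → l ≤ ⋀ X
    atomic     : ∀ x → ¬ (x ≈ ⊥) → ∃ λ a → IsAtom a × a ≤ x
    nontrivial : ¬ (⊤ ≈ ⊥)   -- frames have a non-empty set of worlds
    ◇          : Carrier → Carrier
    ◇-cong     : ∀ {x y} → x ≈ y → ◇ x ≈ ◇ y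
    ◇-⊥        : ◇ ⊥ ≈ ⊥
    ◇-∨        : ∀ x y → ◇ (x ∨ y) ≈ ◇ x ∨ ◇ y

  At : Setoid ℓ ℓ
  At = On.setoid {B = Σ Carrier IsAtom} setoid proj₁

T-ext : ∀ {b c} → (T b → T c) → (T c → T b) → b ≡ c
T-ext {false} {false} _ _ = refl
T-ext {false} {true}  _ g = ⊥-elim (g _)
T-ext {true}  {false} f _ = ⊥-elim (f _)
T-ext {true}  {true}  _ _ = refl

module _ {ℓ} (A : Setoid ℓ ℓ) where

  open Setoid A using () renaming (Carrier to ∣A∣)

  powersetAlgebra : BooleanAlgebra ℓ ℓ
  powersetAlgebra = record
    { Carrier = Subset A
    ; _≈_ = Setoid._≈_ (𝒫 A)
    ; _∨_ = λ X Y → record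
        { to = λ a → (X ⟨$⟩ a) or (Y ⟨$⟩ a)
        ; cong = λ e → cong₂ _or_ (Func.cong X e) (Func.cong Y e) }
    ; _∧_ = λ X Y → record
        { to = λ a → (X ⟨$⟩ a) and (Y ⟨$⟩ a)
        ; cong = λ e → cong₂ _and_ (Func.cong X e) (Func.cong Y e) }
    ; ¬_ = λ X → record
        { to = λ a → not (X ⟨$⟩ a) ; cong = λ e → cong not (Func.cong X e) }
    ; ⊤ = record { to = λ _ → true ; cong = λ _ → refl }
    ; ⊥ = record { to = λ _ → false ; cong = λ _ → refl }
    ; isBooleanAlgebra = record
      { isDistributiveLattice = record
        { isLattice = record
          { isEquivalence = Setoid.isEquivalence (𝒫 A)
          ; ∨-comm  = λ X Y a → ∨-comm (X ⟨$⟩ a) (Y ⟨$⟩ a)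
          ; ∨-assoc = λ X Y Z a → ∨-assoc (X ⟨$⟩ a) (Y ⟨$⟩ a) (Z ⟨$⟩ a)
          ; ∨-cong  = λ p q a → cong₂ _or_ (p a) (q a)
          ; ∧-comm  = λ X Y a → ∧-comm (X ⟨$⟩ a) (Y ⟨$⟩ a)
          ; ∧-assoc = λ X Y Z a → ∧-assoc (X ⟨$⟩ a) (Y ⟨$⟩ a) (Z ⟨$⟩ a)
          ; ∧-cong  = λ p q a → cong₂ _and_ (p a) (q a)
          ; absorptive =
              (λ X Y a → ∨-abs-∧ (X ⟨$⟩ a) (Y ⟨$⟩ a)) ,
              (λ X Y a → ∧-abs-∨ (X ⟨$⟩ a) (Y ⟨$⟩ a))
          }
        ; ∨-distrib-∧ =
            (λ X Y Z a → proj₁ ∨-distrib-∧ (X ⟨$⟩ a) (Y ⟨$⟩ a) (Z ⟨$⟩ a)) ,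
            (λ X Y Z a → proj₂ ∨-distrib-∧ (X ⟨$⟩ a) (Y ⟨$⟩ a) (Z ⟨$⟩ a))
        ; ∧-distrib-∨ =
            (λ X Y Z a → proj₁ ∧-distrib-∨ (X ⟨$⟩ a) (Y ⟨$⟩ a) (Z ⟨$⟩ a)) ,
            (λ X Y Z a → proj₂ ∧-distrib-∨ (X ⟨$⟩ a) (Y ⟨$⟩ a) (Z ⟨$⟩ a))
        }
      ; ∨-complement = (λ X a → proj₁ ∨-inverse (X ⟨$⟩ a)) , (λ X a → proj₂ ∨-inverse (X ⟨$⟩ a))
      ; ∧-complement = (λ X a → proj₁ ∧-inverse (X ⟨$⟩ a)) , (λ X a → proj₂ ∧-inverse (X ⟨$⟩ a))
      ; ¬-cong = λ p a → cong not (p a)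
      }
    }

  private
    module P = BooleanAlgebra powersetAlgebra
    open Poset (LatticeProperties.poset P.lattice) using (_≤_)

  ⊆⇒≤ : (X Y : Subset A) → X ⊆ Y → X ≤ Y
  ⊆⇒≤ X Y sub a = T-ext
    (λ p → Equivalence.from T-∧ (p , sub a p))
    (λ p → proj₁ (Equivalence.to T-∧ p))

  ≤⇒⊆ : (X Y : Subset A) → X ≤ Y → X ⊆ Y
  ≤⇒⊆ X Y X≤Y a p = proj₂ (Equivalence.to T-∧ (subst T (X≤Y a) p))

module _ {ℓ} (em : ExcludedMiddle ℓ) where

  stable : ∀ {P : Set ℓ} → ¬ ¬ P → P
  stable = decidable-stable em

  -- Opaque, so that the predicate can be inferred from a membership.
  opaque
    comprehension : (A : Setoid ℓ ℓ) (P : Setoid.Carrier A → Set ℓ) →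
                    (∀ {a b} → Setoid._≈_ A a b → P a → P b) → Subset A
    comprehension A P resp = record
      { to   = λ a → isYes (em {P a})
      ; cong = λ {a} {b} e → T-ext
          (λ p → fromWitness {a? = em {P b}} (resp e (toWitness {a? = em {P a}} p)))
          (λ p → fromWitness {a? = em {P a}} (resp (Setoid.sym A e) (toWitness {a? = em {P b}} p)))
      }

    ∈-elim : ∀ {A P} {resp : ∀ {a b} → Setoid._≈_ A a b → P a → P b} {a} →
             a ∈ comprehension A P resp → P a
    ∈-elim {P = P} {a = a} = toWitness {a? = em {P a}}

    ∈-intro : ∀ {A P} {resp : ∀ {a b} → Setoid._≈_ A a b → P a → P b} {a} →
              P a → a ∈ comprehension A P resp
    ∈-intro {P = P} {a = a} = fromWitness {a? = em {P a}}

  module _ (A : Setoid ℓ ℓ) where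

    open Setoid A

    ∅ : Subset A
    ∅ = BooleanAlgebra.⊥ (powersetAlgebra A)

    pair : Carrier → Carrier → Subset A
    pair p q = comprehension A (λ a → a ≈ p ⊎ a ≈ q)
      λ { e (inj₁ h) → inj₁ (Setoid.trans A (Setoid.sym A e) h)
        ; e (inj₂ h) → inj₂ (Setoid.trans A (Setoid.sym A e) h) }

    singleton : Carrier → Subset A
    singleton p = comprehension A (_≈ p) (λ e h → Setoid.trans A (Setoid.sym A e) h)

  module _ (κ : RegularCardinal ℓ) where

    open RegularCardinal κ using (segment; isStrictTotalOrder; infinite; _<_)
    open IsStrictTotalOrder isStrictTotalOrder using (compare) renaming (trans to <-trans)

    ∅-small : (A : Setoid ℓ ℓ) → ⟪ ∅ A ⟫ ≺ κ
    ∅-small A = Injection.to infinite 0 , record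
      { to = λ () ; cong = λ { {()} } ; injective = λ { {()} } }

    private
      two-below : ∃ λ k → ∃ λ i → ∃ λ j → i < k × j < k × ¬ (i ≡ j)
      two-below = go (compare a b) (compare b c) (compare a c)
        where
        open Injection infinite using () renaming (to to ι; injective to ι-inj)
        a = ι 0
        b = ι 1
        c = ι 2
        a≢b : ¬ (a ≡ b)
        a≢b e with () ← ι-inj e
        b≢c : ¬ (b ≡ c)
        b≢c e with () ← ι-inj e
        a≢c : ¬ (a ≡ c)
        a≢c e with () ← ι-inj e
        go : _ → _ → _ → _
        go (tri≈ _ e _) _ _ = ⊥-elim (a≢b e)
        go _ (tri≈ _ e _) _ = ⊥-elim (b≢c e)
        go _ _ (tri≈ _ e _) = ⊥-elim (a≢c e)
        go (tri< p _ _) (tri< q _ _) _ = c , a , b , <-trans p q , q , a≢b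
        go (tri< p _ _) (tri> _ _ q) _ = b , a , c , p , q , a≢c
        go (tri> _ _ p) _ (tri< q _ _) = c , a , b , q , <-trans p q , a≢b
        go (tri> _ _ p) _ (tri> _ _ q) = a , b , c , p , q , b≢c

    pair-small : (A : Setoid ℓ ℓ) (p q : Setoid.Carrier A) → ⟪ pair A p q ⟫ ≺ κ
    pair-small A p q with two-below
    ... | k , i , j , i<k , j<k , i≢j = k , record
      { to = λ (a , _) → f a
      ; cong = λ {x} {y} → f-cong (proj₁ x) (proj₁ y)
      ; injective = λ {x} {y} → f-inj x y }
      where
      module A = Setoid A
      f : A.Carrier → ∃ λ l → l < k
      f a with em {a A.≈ p}
      ... | yes _ = i , i<k
      ... | no  _ = j , j<k
      f-cong : ∀ a b → a A.≈ b → proj₁ (f a) ≡ proj₁ (f b)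
      f-cong a b e with em {a A.≈ p} | em {b A.≈ p}
      ... | yes _ | yes _ = refl
      ... | no  _ | no  _ = refl
      ... | yes h | no ¬h = ⊥-elim (¬h (A.trans (A.sym e) h))
      ... | no ¬h | yes h = ⊥-elim (¬h (A.trans e h))
      other : ∀ (x : Setoid.Carrier ⟪ pair A p q ⟫) → ¬ (proj₁ x A.≈ p) → proj₁ x A.≈ q
      other (_ , m) ¬h with ∈-elim m
      ... | inj₁ h = ⊥-elim (¬h h)
      ... | inj₂ h = h
      f-inj : ∀ (x y : Setoid.Carrier ⟪ pair A p q ⟫) →
              proj₁ (f (proj₁ x)) ≡ proj₁ (f (proj₁ y)) → proj₁ x A.≈ proj₁ y
      f-inj x y e with em {proj₁ x A.≈ p} | em {proj₁ y A.≈ p}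
      ... | yes g | yes h = A.trans g (A.sym h)
      ... | no ¬g | no ¬h = A.trans (other x ¬g) (A.sym (other y ¬h))
      ... | yes _ | no  _ = ⊥-elim (i≢j e)
      ... | no  _ | yes _ = ⊥-elim (i≢j (sym e))

    module _ (A : CompleteAtomicModalAlgebra ℓ) where

      private
        module A = CompleteAtomicModalAlgebra A
        open A using (_≈_; _≤_; ⋀; ◇)
        module ≤ = Poset (LatticeProperties.poset A.lattice)

      ◇-above : Subset A.setoid → A.Carrier → Subset A.setoid
      ◇-above X c = comprehension A.setoid
        (λ y → ∃ λ x → x ∈ X × c ≤ x × y ≈ ◇ x)
        λ { e (x , x∈X , c≤x , h) → x , x∈X , c≤x , ≤.Eq.trans (≤.Eq.sym e) h }

      R : Subset A.setoid → Subset (A.At ×ₛ A.At)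
      R X = comprehension (A.At ×ₛ A.At)
        (λ ((a , _) , (c , _)) → a ≤ ⋀ (◇-above X c))
        λ { {_ , (c , _)} {_ , (c′ , _)} (a≈a′ , c≈c′) h →
            ≤.trans (≤.reflexive (≤.Eq.sym a≈a′)) (≤.trans h
              (A.⋀-greatest (◇-above X c′) _ λ y y∈ → A.⋀-lower (◇-above X c) y
                (let (x , x∈X , c′≤x , y≈◇x) = ∈-elim y∈ in
                 ∈-intro (x , x∈X , ≤.trans (≤.reflexive c≈c′) c′≤x , y≈◇x)))) }

      F : Frame ℓ
      F = record
        { W     = A.At
        ; S     = comprehension (Relation A.At)
                    (λ Q → ∃ λ X → ⟪ X ⟫ ≺ κ × Setoid._≈_ (Relation A.At) Q (R X))
                    λ { {Q} {Q′} e (X , X≺κ , h) → X , X≺κ ,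
                        Setoid.trans (Relation A.At) {Q′} {Q} {R X}
                          (Setoid.sym (Relation A.At) {Q} {Q′} e) h }
        ; world = let (a , isAtom , _) = A.atomic A.⊤ A.nontrivial in a , isAtom
        ; rel   = R (∅ A.setoid) ,
                  ∈-intro (∅ A.setoid , ∅-small A.setoid , λ _ → refl)
        }

    module _ (M : Frame ℓ) where

      open Frame M
      private
        B = powersetAlgebra W
        module B = BooleanAlgebra B
        open BooleanAlgebra B using (_∨_; ⊥)
        open Poset (LatticeProperties.poset B.lattice) using (_≤_)
        module W = Setoid W

      ◇ₘ : Subset W → Subset W
      ◇ₘ X = comprehension W
        (λ w → ∀ Q → Q ∈ S → ∃ λ x → x ∈ X × (w , x) ∈ Q)
        λ { e h Q Q∈S → let (x , x∈X , wQx) = h Q Q∈S in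
            x , x∈X , ∈-resp {A = W ×ₛ W} Q (e , W.refl) wQx }

      singleton-isAtom : (w : World) →
        ¬ (singleton W w B.≈ ⊥) × (∀ X → X ≤ singleton W w → X B.≈ ⊥ ⊎ X B.≈ singleton W w)
      singleton-isAtom w =
        (λ e → subst T (e w) (∈-intro W.refl)) ,
        λ X X≤w → case X X≤w (em {Lift ℓ (w ∈ X)})
        where
        case : ∀ X → X ≤ singleton W w → _ → X B.≈ ⊥ ⊎ X B.≈ singleton W w
        case X X≤w (yes (lift w∈X)) = inj₂ λ a → T-ext
          (≤⇒⊆ W X (singleton W w) X≤w a)
          (λ p → ∈-resp X (W.sym (∈-elim p)) w∈X)
        case X X≤w (no w∉X) = inj₁ λ a → T-ext
          (λ p → w∉X (lift
            (∈-resp X (∈-elim (≤⇒⊆ W X (singleton W w) X≤w a p)) p)))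
          λ ()

      ⋃ : Subset (𝒫 W) → Subset W
      ⋃ 𝒳 = comprehension W (λ w → ∃ λ X → X ∈ 𝒳 × w ∈ X)
        λ { e (X , m , p) → X , m , ∈-resp X e p }

      ⋂ : Subset (𝒫 W) → Subset W
      ⋂ 𝒳 = comprehension W (λ w → ∀ X → X ∈ 𝒳 → w ∈ X)
        λ e h X m → ∈-resp X e (h X m)

      -- Directedness is used only for the additivity of ◇.
      module _ (directed : DownwardDirected κ M) where

        private
          ◇-mono : ∀ X Y → X ⊆ Y → ◇ₘ X ⊆ ◇ₘ Y
          ◇-mono X Y sub w p = ∈-intro λ Q Q∈S →
            let (x , x∈X , wQx) = ∈-elim p Q Q∈S in x , sub x x∈X , wQx

          below : ∀ Q₁ Q₂ → Q₁ ∈ S → Q₂ ∈ S →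
            ∃ λ Q → Q ∈ S × Q ⊆ Q₁ × Q ⊆ Q₂
          below Q₁ Q₂ m₁ m₂
            with directed (pair (Relation W) Q₁ Q₂) sub (pair-small (Relation W) Q₁ Q₂)
            where
            sub : pair (Relation W) Q₁ Q₂ ⊆ S
            sub Q p with ∈-elim p
            ... | inj₁ e = ∈-resp S {Q₁} {Q} (Setoid.sym (Relation W) {Q} {Q₁} e) m₁
            ... | inj₂ e = ∈-resp S {Q₂} {Q} (Setoid.sym (Relation W) {Q} {Q₂} e) m₂
          ... | Q , Q∈S , h = Q , Q∈S ,
            (λ (x , y) p → h x y p Q₁ (∈-intro (inj₁ λ _ → refl))) ,
            (λ (x , y) p → h x y p Q₂ (∈-intro (inj₂ λ _ → refl)))

          ∉◇ : ∀ X w → ¬ (w ∈ ◇ₘ X) →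
            ∃ λ Q → Q ∈ S × (∀ x → x ∈ X → ¬ ((w , x) ∈ Q))
          ∉◇ X w ∉ = stable λ none → ∉ (∈-intro λ Q Q∈S → stable λ no-x →
            none (Q , Q∈S , λ x x∈X wQx → no-x (x , x∈X , wQx)))

          ◇-∨-⊆ : ∀ X Y → ◇ₘ (X ∨ Y) ⊆ (◇ₘ X ∨ ◇ₘ Y)
          ◇-∨-⊆ X Y w p = lower {ℓ = ℓ} (stable λ ∉ →
            let (Q₁ , m₁ , n₁) = ∉◇ X w (∉ ∘ lift ∘ Equivalence.from T-∨ ∘ inj₁)
                (Q₂ , m₂ , n₂) = ∉◇ Y w (∉ ∘ lift ∘ Equivalence.from (T-∨ {◇ₘ X ⟨$⟩ w}) ∘ inj₂)
                (Q , m , s₁ , s₂) = below Q₁ Q₂ m₁ m₂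
                (x , x∈ , wQx) = ∈-elim p Q m
            in clash Q₁ Q₂ n₁ n₂ (s₁ (w , x) wQx) (s₂ (w , x) wQx) (Equivalence.to T-∨ x∈))
            where
            clash : ∀ (Q₁ Q₂ : Subset (W ×ₛ W)) {x} →
              (∀ x → x ∈ X → ¬ ((w , x) ∈ Q₁)) → (∀ x → x ∈ Y → ¬ ((w , x) ∈ Q₂)) →
              (w , x) ∈ Q₁ → (w , x) ∈ Q₂ → (x ∈ X) ⊎ (x ∈ Y) → Empty
            clash Q₁ Q₂ n₁ n₂ p q (inj₁ h) = n₁ _ h p
            clash Q₁ Q₂ n₁ n₂ p q (inj₂ h) = n₂ _ h q

        G : CompleteAtomicModalAlgebra ℓ
        G = record
          { booleanAlgebra = B
          ; ⋁ = ⋃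
          ; ⋀ = ⋂
          ; ⋁-upper = λ 𝒳 X m → ⊆⇒≤ W X (⋃ 𝒳) λ w p → ∈-intro (X , m , p)
          ; ⋁-least = λ 𝒳 U h → ⊆⇒≤ W (⋃ 𝒳) U λ w p →
              let (X , m , q) = ∈-elim p in ≤⇒⊆ W X U (h X m) w q
          ; ⋀-lower = λ 𝒳 X m → ⊆⇒≤ W (⋂ 𝒳) X λ w p → ∈-elim p X m
          ; ⋀-greatest = λ 𝒳 L h → ⊆⇒≤ W L (⋂ 𝒳) λ w p →
              ∈-intro λ X m → ≤⇒⊆ W L X (h X m) w p
          ; atomic = λ X X≢⊥ → stable λ none → X≢⊥ λ a → T-ext
              (λ a∈X → none (singleton W a , singleton-isAtom a ,
                ⊆⇒≤ W (singleton W a) X λ b p → ∈-resp X (W.sym (∈-elim p)) a∈X))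
              λ ()
          ; nontrivial = λ e → subst T (e world) _
          ; ◇ = ◇ₘ
          ; ◇-cong = λ {X} {Y} e w → T-ext
              (◇-mono X Y (λ a → subst T (e a)) w)
              (◇-mono Y X (λ a → subst T (sym (e a))) w)
          ; ◇-⊥ = λ w → T-ext
              (λ p → let (Q , m) = rel in proj₁ (proj₂ (∈-elim p Q m)))
              λ ()
          ; ◇-∨ = λ X Y w → T-ext (◇-∨-⊆ X Y w)
              (λ p → join X Y w (Equivalence.to T-∨ p))
          }
          where
          join : ∀ X Y w → (w ∈ ◇ₘ X) ⊎ (w ∈ ◇ₘ Y) → w ∈ ◇ₘ (X ∨ Y)
          join X Y w (inj₁ p) = ◇-mono X (X ∨ Y) (λ _ → Equivalence.from T-∨ ∘ inj₁) w p
          join X Y w (inj₂ p) = ◇-mono Y (X ∨ Y) (λ a → Equivalence.from (T-∨ {X ⟨$⟩ a}) ∘ inj₂) w p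

        θ : Func W (CompleteAtomicModalAlgebra.At G)
        θ = record
          { to   = λ w → singleton W w , singleton-isAtom w
          ; cong = λ e a → T-ext
              (λ p → ∈-intro (W.trans (∈-elim p) e))
              (λ p → ∈-intro (W.trans (∈-elim p) (W.sym e)))
          }

{-# OPTIONS --safe #-}

-- θ is a bijection because every atom of a powerset algebra is a singleton.
-- Forth: given fewer than κ sets Y, choose for each Y with x ∉ ◇Y a relation of
-- S under which x sees no point of Y; by κ-directedness some R₁ ∈ S is contained
-- in all of them, so x R₁ y and y ∈ Y force x ∈ ◇Y.
-- Back: for R₁ ∈ S take X = {Y} with Y the set of points that x does not
-- R₁-see.  Since x ∉ ◇Y, {x} R(X) {y} implies y ∉ Y, that is x R₁ y.

module Submission where

open import Defs
import Algebra.Lattice.Properties.Lattice as LatticeProperties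
open import Axiom.ExcludedMiddle using (ExcludedMiddle)
open import Data.Bool.Base using (T)
open import Data.Bool.Properties using (T?)
open import Data.Empty using (⊥-elim)
open import Data.Product.Base using (∃; _×_; _,_; proj₁; proj₂)
open import Data.Product.Relation.Binary.Pointwise.NonDependent using (_×ₛ_)
open import Data.Sum.Base using (inj₁; inj₂)
open import Function.Bundles using (Func; Injection; _⟨$⟩_)
open import Function.Definitions using (Injective; Surjective)
open import Induction.WellFounded using (Acc; acc)
open import Level using (Lift; lift; lower)
open import Relation.Binary.Bundles using (Setoid; Poset)
open import Relation.Binary.Definitions using (tri<; tri≈; tri>)
open import Relation.Binary.PropositionalEquality using (_≡_; refl; sym; trans; cong; subst)
open import Relation.Binary.Structures using (IsStrictTotalOrder)
open import Relation.Nullary using (¬_; yes; no; decidable-stable)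

-- Membership is Boolean-valued and hence decidable outright, whereas `em` decides types at level
-- `ℓ` only.
∈-stable : ∀ {ℓ} {A : Setoid ℓ ℓ} (X : Subset A) {a} → ¬ ¬ (a ∈ X) → a ∈ X
∈-stable X {a} = decidable-stable (T? (X ⟨$⟩ a))

module _ {ℓ} (em : ExcludedMiddle ℓ) (κ : RegularCardinal ℓ) where

  open RegularCardinal κ
  open IsStrictTotalOrder isStrictTotalOrder using (compare)

  -- Descent: as long as a smaller witness exists, pass to it; accessibility bounds the process.
  least : (P : Carrier → Set ℓ) → ∀ {j} → P j →
          ∃ λ m → P m × (∀ i → P i → ¬ (i < m))
  least P {j} = go (wellFounded j)
    where
    go : ∀ {j} → Acc _<_ j → P j → ∃ λ m → P m × (∀ i → P i → ¬ (i < m))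
    go {j} (acc rs) p with em {∃ λ i → P i × i < j}
    ... | yes (i , q , i<j) = go (rs i<j) q
    ... | no none = j , p , λ i q i<j → none (i , q , i<j)

  module _ (A : Setoid ℓ ℓ) (q : Carrier → Setoid.Carrier A) (k : Carrier) where

    private
      module A = Setoid A

      Hits : A.Carrier → Carrier → Set ℓ
      Hits a j = j < k × a A.≈ q j

    -- Serves as the family handed to directedness: one relation is chosen per index below `k`.
    segmentImage : Subset A
    segmentImage = comprehension em A (λ a → ∃ (Hits a))
      λ { e (j , j<k , h) → j , j<k , A.trans (A.sym e) h }

    -- Each element of the image is sent to its least preimage, which depends
    -- only on its ≈-class.
    segmentImage-small : ⟪ segmentImage ⟫ ≺ κ
    segmentImage-small = k , record
      { to = λ x → index x , proj₁ (hits x)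
      ; cong = λ {x} {y} → index-cong x y
      ; injective = λ {x} {y} e →
          A.trans (proj₂ (hits x)) (A.trans (A.reflexive (cong q e)) (A.sym (proj₂ (hits y))))
      }
      where
      Image = Setoid.Carrier ⟪ segmentImage ⟫

      leastIndex : (x : Image) →
        ∃ λ m → Hits (proj₁ x) m × (∀ i → Hits (proj₁ x) i → ¬ (i < m))
      leastIndex x = least (Hits (proj₁ x)) (proj₂ (∈-elim em (proj₂ x)))

      index : Image → Carrier
      index x = proj₁ (leastIndex x)

      hits : ∀ x → Hits (proj₁ x) (index x)
      hits x = proj₁ (proj₂ (leastIndex x))

      minimal : ∀ x i → Hits (proj₁ x) i → ¬ (i < index x)
      minimal x = proj₂ (proj₂ (leastIndex x))

      transport : ∀ {a b j} → a A.≈ b → Hits a j → Hits b j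
      transport e (j<k , h) = j<k , A.trans (A.sym e) h

      index-cong : ∀ x y → proj₁ x A.≈ proj₁ y → index x ≡ index y
      index-cong x y e with compare (index x) (index y)
      ... | tri< lt _ _ = ⊥-elim (minimal y _ (transport e (hits x)) lt)
      ... | tri≈ _ eq _ = eq
      ... | tri> _ _ gt = ⊥-elim (minimal x _ (transport (A.sym e) (hits y)) gt)

module _ {ℓ} (em : ExcludedMiddle ℓ) (κ : RegularCardinal ℓ) (M : Frame ℓ)
         (directed : DownwardDirected κ M) where

  open Frame M

  private
    module W = Setoid W
    module κ = RegularCardinal κ
    module A = CompleteAtomicModalAlgebra (G em κ M directed)
    module FG = Frame (F em κ (G em κ M directed))

    𝒫W = 𝒫 W
    RelW = Relation W
    RelAt = Relation A.At

    [_] : World → Subset W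
    [ w ] = singleton em W w

    θM : Func W A.At
    θM = θ em κ M directed

    ◇M : Subset W → Subset W
    ◇M = ◇ₘ em κ M

    R[_] : Subset 𝒫W → Subset (A.At ×ₛ A.At)
    R[_] = R em κ (G em κ M directed)

  -- A relation of `S` with this property is exactly a witness that `x` lies outside `◇M Y`.
  Avoids : World → Subset W → Subset (W ×ₛ W) → Set ℓ
  Avoids x Y Q = ∀ y → y ∈ Y → ¬ ((x , y) ∈ Q)

  ∉◇⇒avoids : ∀ x Y → ¬ (x ∈ ◇M Y) → ∃ λ Q → Q ∈ S × Avoids x Y Q
  ∉◇⇒avoids x Y x∉ = stable em λ none → x∉ (∈-intro em λ Q Q∈S →
    stable em λ no-y → none (Q , Q∈S , λ y y∈Y xQy → no-y (y , y∈Y , xQy)))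

  avoids⇒∉◇ : ∀ x Y Q → Q ∈ S → Avoids x Y Q → ¬ (x ∈ ◇M Y)
  avoids⇒∉◇ x Y Q Q∈S avoids x∈ =
    let (y , y∈Y , xQy) = ∈-elim em x∈ Q Q∈S in avoids y y∈Y xQy

  -- Avoidance passes to subrelations, so a common lower bound in `S` of the chosen witnesses serves
  -- every `Y` at once.
  smallAvoidance : ∀ x (X : Subset 𝒫W) → ⟪ X ⟫ ≺ κ →
    ∃ λ R₁ → R₁ ∈ S × (∀ Y → Y ∈ X → ¬ (x ∈ ◇M Y) → Avoids x Y R₁)
  smallAvoidance x X (k , f) =
    let (R₁ , R₁∈S , below) = directed S′ S′⊆S (segmentImage-small em κ RelW q k)
    in R₁ , R₁∈S , λ Y Y∈X x∉ y y∈Y xR₁y →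
      let (j , j<k) = f.to (Y , Y∈X)
      in proj₂ (proj₂ (chosen j)) Y Y∈X refl x∉ y y∈Y
           (below x y xR₁y (q j) (∈-intro em (j , j<k , λ _ → refl)))
    where
    module f = Injection f

    -- Choosing along the indices j rather than the sets Y makes the choice
    -- respect ≈ without further work.
    chosen : ∀ j → ∃ λ Q → Q ∈ S ×
      (∀ Y (Y∈X : Y ∈ X) → proj₁ (f.to (Y , Y∈X)) ≡ j → ¬ (x ∈ ◇M Y) → Avoids x Y Q)
    chosen j with em {∃ λ Y → ∃ λ (Y∈X : Y ∈ X) → proj₁ (f.to (Y , Y∈X)) ≡ j × ¬ (x ∈ ◇M Y)}
    ... | yes (Y , Y∈X , e , x∉) =
      let (Q , Q∈S , avoids) = ∉◇⇒avoids x Y x∉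
      in Q , Q∈S , λ Y′ Y′∈X e′ _ y y∈Y′ →
        -- `Y` and `Y′` share the index `j`, so injectivity of `f` makes them the same subset.
        avoids y (subst T (f.injective (trans e′ (sym e)) y) y∈Y′)
    -- No set with index `j` imposes a condition here, so any relation of `S` will do.
    ... | no none = proj₁ rel , proj₂ rel , λ Y Y∈X e x∉ → ⊥-elim (none (Y , Y∈X , e , x∉))

    q : κ.Carrier → Subset (W ×ₛ W)
    q j = proj₁ (chosen j)

    S′ : Subset RelW
    S′ = segmentImage em κ RelW q k

    S′⊆S : S′ ⊆ S
    S′⊆S Q Q∈S′ =
      let (j , _ , Q≈qj) = ∈-elim em Q∈S′
      in ∈-resp S {q j} {Q} (Setoid.sym RelW {Q} {q j} Q≈qj) (proj₁ (proj₂ (chosen j)))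

  -- On singletons the order is membership: `[ y ] ≤ Y` means `y ∈ Y`, and `[ x ] ≤ ◇M Y` means
  -- `x ∈ ◇M Y`. With its converse `R-elim`, this turns `R[ X ]` into a condition on points.
  R-intro : ∀ X x y → (∀ Y → Y ∈ X → y ∈ Y → x ∈ ◇M Y) →
            (θM ⟨$⟩ x , θM ⟨$⟩ y) ∈ R[ X ]
  R-intro X x y h = ∈-intro em (A.⋀-greatest (◇-above em κ (G em κ M directed) X [ y ]) [ x ]
    λ Z Z∈ → ⊆⇒≤ W [ x ] Z λ w w∈ →
      let (Y , Y∈X , y≤Y , Z≈◇Y) = ∈-elim em Z∈
          y∈Y = ≤⇒⊆ W [ y ] Y y≤Y y (∈-intro em W.refl)
      in ∈-resp Z (W.sym (∈-elim em w∈))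
           (subst T (sym (Z≈◇Y x)) (h Y Y∈X y∈Y)))

  -- Since `[ y ] ≤ Y`, the set `◇M Y` is itself a member of the family whose meet lies above
  -- `[ x ]`.
  R-elim : ∀ X x y → (θM ⟨$⟩ x , θM ⟨$⟩ y) ∈ R[ X ] →
           ∀ Y → Y ∈ X → y ∈ Y → x ∈ ◇M Y
  R-elim X x y r Y Y∈X y∈Y = ≤⇒⊆ W [ x ] (◇M Y) x≤◇Y x (∈-intro em W.refl)
    where
    module ≤ = Poset (LatticeProperties.poset A.lattice)
    above = ◇-above em κ (G em κ M directed) X [ y ]
    y≤Y : [ y ] A.≤ Y
    y≤Y = ⊆⇒≤ W [ y ] Y λ w w∈ → ∈-resp Y (W.sym (∈-elim em w∈)) y∈Y
    x≤◇Y : [ x ] A.≤ ◇M Y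
    x≤◇Y = ≤.trans {[ x ]} {A.⋀ above} {◇M Y} (∈-elim em r)
      (A.⋀-lower above (◇M Y) (∈-intro em (Y , Y∈X , y≤Y , λ _ → refl)))

  θ-injective : Injective W._≈_ (Setoid._≈_ A.At) (θM ⟨$⟩_)
  θ-injective {x} {y} e = ∈-elim em (subst T (e x) (∈-intro em W.refl))

  -- A nonzero `U` contains some `w`; then `[ w ]` lies below `U` and is nonzero, so minimality
  -- forces equality.
  atom-isSingleton : ∀ u → ∃ λ w → Setoid._≈_ A.At (θM ⟨$⟩ w) u
  atom-isSingleton (U , U≉⊥ , minimal) with em {∃ λ w → w ∈ U}
  ... | no empty = ⊥-elim (U≉⊥ λ w → T-ext (λ w∈U → empty (w , w∈U)) λ ())
  ... | yes (w , w∈U)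
      with minimal [ w ] (⊆⇒≤ W [ w ] U λ v v∈ → ∈-resp U (W.sym (∈-elim em v∈)) w∈U)
  ... | inj₁ w≈⊥ = ⊥-elim (proj₁ (singleton-isAtom em κ M w) w≈⊥)
  ... | inj₂ w≈U = w , w≈U

  θ-surjective : Surjective W._≈_ (Setoid._≈_ A.At) (θM ⟨$⟩_)
  θ-surjective u =
    let (w , w≈u) = atom-isSingleton u
    in w , λ {z} z≈w → Setoid.trans A.At {θM ⟨$⟩ z} {θM ⟨$⟩ w} {u} (Func.cong θM z≈w) w≈u

  θ-forth : ∀ x R₂ → R₂ ∈ FG.S →
            ∃ λ R₁ → R₁ ∈ S × (∀ y → (x , y) ∈ R₁ → (θM ⟨$⟩ x , θM ⟨$⟩ y) ∈ R₂)
  θ-forth x R₂ R₂∈S =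
    let (X , X≺κ , R₂≈R[X]) = ∈-elim em R₂∈S
        (R₁ , R₁∈S , avoids) = smallAvoidance x X X≺κ
    in R₁ , R₁∈S , λ y xR₁y → subst T (sym (R₂≈R[X] (θM ⟨$⟩ x , θM ⟨$⟩ y)))
         (R-intro X x y λ Y Y∈X y∈Y →
           ∈-stable (◇M Y) λ x∉ → avoids Y Y∈X x∉ y y∈Y xR₁y)

  θ-back : ∀ x R₁ → R₁ ∈ S →
           ∃ λ R₂ → R₂ ∈ FG.S × (∀ u → (θM ⟨$⟩ x , u) ∈ R₂ →
             ∃ λ y → (x , y) ∈ R₁ × Setoid._≈_ A.At (θM ⟨$⟩ y) u)
  θ-back x R₁ R₁∈S = R[ X ] , ∈-intro em (X , pair-small em κ 𝒫W Y Y , λ _ → refl) , λ u r →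
    let (y , y≈u) = atom-isSingleton u
        r′ = ∈-resp {A = A.At ×ₛ A.At} R[ X ] {θM ⟨$⟩ x , u} {θM ⟨$⟩ x , θM ⟨$⟩ y}
               ((λ _ → refl) , Setoid.sym A.At {θM ⟨$⟩ y} {u} y≈u) r
    -- If `x` did not `R₁`-see `y`, then `y ∈ Y` and `R-elim` would give `x ∈ ◇M Y`, which `R₁`
    -- itself refutes.
    in y , ∈-stable {A = W ×ₛ W} R₁ (λ ¬xR₁y → avoids⇒∉◇ x Y R₁ R₁∈S (λ _ y∈Y → lower (∈-elim em y∈Y))
             (R-elim X x y r′ Y (∈-intro em (inj₁ λ _ → refl)) (∈-intro em (lift ¬xR₁y))))
         , y≈u
    where
    Y : Subset W
    -- `Lift` brings the negated membership to level `ℓ`, as `comprehension` requires.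
    Y = comprehension em W (λ y → Lift ℓ (¬ ((x , y) ∈ R₁)))
      λ e (lift ¬xR₁y) → lift λ xR₁y → ¬xR₁y (∈-resp {A = W ×ₛ W} R₁ (W.refl , W.sym e) xR₁y)
    X : Subset 𝒫W
    -- The singleton of `Y` as a degenerate pair, so that `pair-small` bounds its size.
    X = pair em 𝒫W Y Y

theorem9p4 : ∀ {ℓ} (em : ExcludedMiddle ℓ) (κ : RegularCardinal ℓ) (M : Frame ℓ)
    (directed : DownwardDirected κ M) →
    IsIsomorphism M (F em κ (G em κ M directed)) (θ em κ M directed)
theorem9p4 em κ M directed = record
  { isHomomorphism = record
    { forth = θ-forth em κ M directed
    ; back  = θ-back em κ M directed
    }
  ; bijective = θ-injective em κ M directed , θ-surjective em κ M directed
  }
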